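{- Let $k\ge 1$ and let $\pi=00\cdots 0$ be the pattern consisting of $k$ zeros. Then for all $n\ge 1$, \[ |\mathbf{I}_n(\pi)| = |L_{n+1,k-1}|. \]
   Context: An inversion sequence of length $n$ is a sequence of integers $e=e_1\cdots e_n$ with $0\le e_i<i$ for all $1\le i\le n$; the set of these is $\mathbf{I}_n$. A sequence $e$ contains a pattern (finite integer sequence) $\pi$ of length $k$ if there are indices $i_1<\cdots<i_k$ such that $e_{i_1}\cdots e_{i_k}$ is order isomorphic to $\pi$ (i.e. its entries compare pairwise, with respect to $<,=,>$, exactly as the corresponding entries of $\pi$); otherwise it avoids $\pi$. $\mathbf{I}_n(\pi)$ is the set of $e\in\mathbf{I}_n$ avoiding $\pi$. A label-increasing tree on $n$ vertices is a rooted unordered tree in which the $n$ vertices are labeled with distinct labels from $\{0,\dots,n-1\}$ and labels increase along any path from the root to a leaf. It has branching bounded by $k$ if each vertex has at most $k$ children. $L_{n,k}$ denotes the set of $n$-vertex label-increasing trees with branching bounded by $k$. -}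

module Defs where

open import Data.Fin.Base as Fin using (Fin; toℕ)
open import Data.Integer.Base as ℤ using (ℤ; +_; 0ℤ)
open import Data.List.Base using (List; []; _∷_; _++_; length)
open import Data.List.Membership.Propositional using (_∈_)
import Data.List.Relation.Binary.Permutation.Homogeneous as Perm
open import Data.List.Relation.Binary.Pointwise.Base using (Pointwise; []; _∷_)
open import Data.List.Relation.Unary.Linked using (Linked)
open import Data.List.Relation.Unary.Unique.Propositional using (Unique)
open import Data.Nat.Base as ℕ using (ℕ; suc)
open import Data.Product.Base using (_×_; proj₁)
open import Data.Vec.Base using (Vec; lookup)
open import Function.Bundles using (_⇔_)
open import Level using (0ℓ)
open import Relation.Binary.Bundles using (Setoid)
import Relation.Binary.Construct.On as On
open import Relation.Binary.PropositionalEquality as ≡ using (_≡_)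
open import Relation.Nullary.Negation.Core using (¬_)

------------------------------------------------------------------------
-- Inversion sequences and patterns

-- The position i : Fin n is the (toℕ i + 1)-st one, hence the bound.
IsInversionSequence : ∀ {n} → Vec ℤ n → Set
IsInversionSequence e =
  ∀ i → 0ℤ ℤ.≤ lookup e i × lookup e i ℤ.< + suc (toℕ i)

-- The comparison by > is the one by < with a and b exchanged.
record Contains {n k : ℕ} (e : Vec ℤ n) (π : Vec ℤ k) : Set where
  field
    index      : Fin k → Fin n
    increasing : ∀ {a b} → a Fin.< b → index a Fin.< index b
    same-<     : ∀ a b → lookup e (index a) ℤ.< lookup e (index b)
                         ⇔ lookup π a ℤ.< lookup π b
    same-≡     : ∀ a b → lookup e (index a) ≡ lookup e (index b)
                         ⇔ lookup π a ≡ lookup π b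

Avoids : ∀ {n k} → Vec ℤ n → Vec ℤ k → Set
Avoids e π = ¬ Contains e π

-- Elements are compared as sequences, ignoring the proofs they carry.
𝐈 : ∀ {k} → ℕ → Vec ℤ k → Setoid 0ℓ 0ℓ
𝐈 n π = On.setoid (≡.setoid (Vec ℤ n)) (proj₁ {B = P})
  where
  P : Vec ℤ n → Set
  P e = IsInversionSequence e × Avoids e π

------------------------------------------------------------------------
-- Rooted unordered trees
--
-- An unordered tree is a rose tree considered up to _≅_, which permutes
-- the children of each vertex.  (Data.Tree.Rose relies on sized types
-- and so is not available with --safe.)

data Tree (A : Set) : Set where
  node : A → List (Tree A) → Tree A

data _≅_ {A : Set} : Tree A → Tree A → Set where
  node : ∀ {a ts us} → Perm.Permutation _≅_ ts us → node a ts ≅ node a us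

module _ {A : Set} where

  mutual
    ≅-refl : (t : Tree A) → t ≅ t
    ≅-refl (node a ts) = node (Perm.refl (≅-refls ts))

    ≅-refls : (ts : List (Tree A)) → Pointwise _≅_ ts ts
    ≅-refls []       = []
    ≅-refls (t ∷ ts) = ≅-refl t ∷ ≅-refls ts

  mutual
    ≅-sym : {t u : Tree A} → t ≅ u → u ≅ t
    ≅-sym (node p) = node (≅-symₚ p)

    ≅-symₚ : {ts us : List (Tree A)} →
             Perm.Permutation _≅_ ts us → Perm.Permutation _≅_ us ts
    ≅-symₚ (Perm.refl eqs)     = Perm.refl (≅-syms eqs)
    ≅-symₚ (Perm.prep eq p)    = Perm.prep (≅-sym eq) (≅-symₚ p)
    ≅-symₚ (Perm.swap eq eq′ p) =
      Perm.swap (≅-sym eq′) (≅-sym eq) (≅-symₚ p)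
    ≅-symₚ (Perm.trans p q)    = Perm.trans (≅-symₚ q) (≅-symₚ p)

    ≅-syms : {ts us : List (Tree A)} → Pointwise _≅_ ts us → Pointwise _≅_ us ts
    ≅-syms []         = []
    ≅-syms (eq ∷ eqs) = ≅-sym eq ∷ ≅-syms eqs

  ≅-trans : {t u v : Tree A} → t ≅ u → u ≅ v → t ≅ v
  ≅-trans (node p) (node q) = node (Perm.trans p q)

unorderedTrees : Set → Setoid 0ℓ 0ℓ
unorderedTrees A = record
  { Carrier       = Tree A
  ; _≈_           = _≅_
  ; isEquivalence = record
    { refl  = λ {t} → ≅-refl t
    ; sym   = ≅-sym
    ; trans = ≅-trans
    }
  }

mutual
  labels : {A : Set} → Tree A → List A
  labels (node a ts) = a ∷ labelss ts

  labelss : {A : Set} → List (Tree A) → List A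
  labelss []       = []
  labelss (t ∷ ts) = labels t ++ labelss ts

-- RootLeafPath t p: p lists the labels along a path from the root of t
-- to a leaf.
data RootLeafPath {A : Set} : Tree A → List A → Set where
  leaf : ∀ {a} → RootLeafPath (node a []) (a ∷ [])
  step : ∀ {a ts t p} → t ∈ ts → RootLeafPath t p →
         RootLeafPath (node a ts) (a ∷ p)

-- s ⊑ t: s consists of a vertex of t together with all its descendants.
data _⊑_ {A : Set} (s : Tree A) : Tree A → Set where
  here  : s ⊑ s
  below : ∀ {a ts t} → t ∈ ts → s ⊑ t → s ⊑ node a ts

BranchingBoundedBy : {A : Set} → ℕ → Tree A → Set
BranchingBoundedBy k t = ∀ {a ts} → node a ts ⊑ t → length ts ℕ.≤ k

-- The label set {0, …, n-1} is Fin n.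
record IsLabelIncreasing {n : ℕ} (t : Tree (Fin n)) : Set where
  field
    size       : length (labels t) ≡ n
    distinct   : Unique (labels t)
    increasing : ∀ {p} → RootLeafPath t p → Linked Fin._<_ p

L : ℕ → ℕ → Setoid 0ℓ 0ℓ
L n k = On.setoid (unorderedTrees (Fin n)) (proj₁ {B = P})
  where
  P : Tree (Fin n) → Set
  P t = IsLabelIncreasing t × BranchingBoundedBy k t

module Submission where

-- Read the i-th entry of an inversion sequence as the label of the parent of
-- vertex i.  Entries being smaller than their position says that labels
-- increase away from the root 0, and the number of occurrences of a value is
-- the number of children of that vertex, so that avoiding k zeros bounds the
-- branching by k ∸ 1.  A tree realizes a sequence if the children of every
-- vertex are the ones prescribed by the sequence: a realization exists and is
-- unique up to ≅, and a label-increasing tree realizes exactly one sequence.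

open import Defs
open import Data.Integer.Base using (0ℤ)
open import Data.Nat.Base using (ℕ; suc; _∸_; _≤_)
open import Data.Vec.Base using (replicate)
open import Function.Bundles using (Inverse)

open import Data.Fin.Base as Fin using (Fin; zero; suc; toℕ; fromℕ<; inject≤)
open import Data.Fin.Induction using (>-wellFounded)
import Data.Fin.Induction as FinInd
import Data.Fin.Properties as Finₚ
open import Data.Integer.Base as ℤ using (ℤ; +_; +≤+; +<+)
import Data.Integer.Properties as ℤₚ
open import Data.List.Base as List using (List; []; _∷_; _++_; length; map; filter; allFin)
import Data.List.Membership.DecPropositional as DecMembership
open import Data.List.Membership.Propositional using (_∈_; _∉_; find)
open import Data.List.Membership.Propositional.Properties
  using (∈-map⁺; ∈-map⁻; ∈-filter⁺; ∈-filter⁻; ∈-allFin; ∈-++⁺ˡ; ∈-++⁺ʳ; ∈-++⁻; ∈-lookup)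
open import Data.List.Membership.Propositional.Properties.WithK using (unique∧set⇒bag)
open import Data.List.Properties using (length-map; length-tabulate; ∷-injective)
open import Data.List.Relation.Binary.BagAndSetEquality using (∼bag⇒↭)
open import Data.List.Relation.Binary.Disjoint.Propositional using (Disjoint)
import Data.List.Relation.Binary.Permutation.Homogeneous as Perm
open import Data.List.Relation.Binary.Permutation.Propositional
  using (_↭_; ↭-reflexive; ↭-sym; ↭-trans; ↭⇒↭ₛ; ↭⇒↭ₛ′; ↭ₛ⇒↭)
open import Data.List.Relation.Binary.Permutation.Propositional.Properties
  using (∈-resp-↭; All-resp-↭; ↭-map-inv; ↭-length)
import Data.List.Relation.Binary.Permutation.Setoid.Properties as PermSetoid
open import Data.List.Relation.Binary.Pointwise.Base using (Pointwise; []; _∷_)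
open import Data.List.Relation.Unary.All as All using (All; []; _∷_)
open import Data.List.Relation.Unary.AllPairs as AllPairs using (AllPairs; []; _∷_)
import Data.List.Relation.Unary.AllPairs.Properties as AllPairsₚ
open import Data.List.Relation.Unary.Any as Any using (here; there)
open import Data.List.Relation.Unary.Any.Properties using (lookup-index)
open import Data.List.Relation.Unary.Linked as Linked using (Linked; [-]; _∷_)
open import Data.List.Relation.Unary.Unique.Propositional using (Unique)
open import Data.List.Relation.Unary.Unique.Propositional.Properties as Uniqueₚ
  using (Unique[x∷xs]⇒x∉xs)
import Data.Nat.Base as ℕ
import Data.Nat.Properties as ℕₚ
open import Data.Product.Base using (∃; _×_; _,_; proj₁; proj₂)
open import Data.Sum.Base using (_⊎_; inj₁; inj₂; [_,_]′)
open import Data.Vec.Base as Vec using (Vec; lookup)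
open import Data.Vec.Properties using (lookup∘tabulate; lookup-replicate)
open import Data.Vec.Relation.Binary.Pointwise.Extensional using (ext; Pointwise-≡⇒≡)
open import Function.Base using (_∘_; id)
open import Function.Bundles using (Equivalence; mk⇔)
open import Induction.WellFounded using (Acc; acc)
open import Level using (Level)
open import Relation.Binary.Bundles using (Setoid)
open import Relation.Binary.Definitions using (tri<; tri≈; tri>)
open import Relation.Binary.PropositionalEquality
  using (_≡_; _≢_; refl; sym; trans; cong; subst; subst₂; setoid)
open import Relation.Nullary using (¬_; contradiction; yes; no)

private
  variable
    ℓ : Level
    A : Set
    m n k : ℕ

-- Duplicate-free lists and indices into them.

Unique-++⁻ : (xs : List A) {ys : List A} → Unique (xs ++ ys) →
             Unique xs × Unique ys × Disjoint xs ys
Unique-++⁻ []       u        = [] , u , λ { (() , _) }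
Unique-++⁻ (x ∷ xs) (x≢ ∷ u) with Unique-++⁻ xs u
... | uxs , uys , disj =
  All.tabulate (All.lookup x≢ ∘ ∈-++⁺ˡ) ∷ uxs , uys ,
  λ { (here refl , y) → All.lookup x≢ (∈-++⁺ʳ xs y) refl
    ; (there x   , y) → disj (x , y) }

unique-↭ : {xs ys : List A} → Unique xs → Unique ys →
           (∀ {x} → x ∈ xs → x ∈ ys) → (∀ {x} → x ∈ ys → x ∈ xs) → xs ↭ ys
unique-↭ u v f g = ∼bag⇒↭ (unique∧set⇒bag u v (mk⇔ f g))

unique-lookup-injective : {xs : List A} → Unique xs → ∀ {i j} →
                          List.lookup xs i ≡ List.lookup xs j → i ≡ j
unique-lookup-injective (_ ∷ _) {zero}  {zero}  eq = refl
unique-lookup-injective {xs = _ ∷ xs} (x≢ ∷ _) {zero} {suc j} eq =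
  contradiction eq (All.lookup x≢ (∈-lookup {xs = xs} j))
unique-lookup-injective {xs = _ ∷ xs} (x≢ ∷ _) {suc i} {zero} eq =
  contradiction (sym eq) (All.lookup x≢ (∈-lookup {xs = xs} i))
unique-lookup-injective (_ ∷ u) {suc i} {suc j} eq = cong suc (unique-lookup-injective u eq)

-- Pigeonhole: a missing `w` could be put in front of `xs`, and lookup would then inject
-- `Fin (suc m)` into `Fin m`.
unique-full : {xs : List (Fin m)} → Unique xs → length xs ≡ m → ∀ w → w ∈ xs
unique-full {xs = xs} u eq w with DecMembership._∈?_ Finₚ._≟_ w xs
... | yes w∈ = w∈
... | no  w∉ = contradiction
  (Finₚ.injective⇒≤ (unique-lookup-injective (All.tabulate w≢ ∷ u)))
  (ℕₚ.<⇒≱ (ℕ.s≤s (ℕₚ.≤-reflexive (sym eq))))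
  where
  w≢ : ∀ {x} → x ∈ xs → w ≢ x
  w≢ x∈ refl = w∉ x∈

index-injective : {xs : List A} {x y : A} (p : x ∈ xs) (q : y ∈ xs) →
                  Any.index p ≡ Any.index q → x ≡ y
index-injective {xs = xs} p q eq =
  trans (lookup-index p) (trans (cong (List.lookup xs) eq) (sym (lookup-index q)))

AllPairs-lookup : {R : A → A → Set} {xs : List A} → AllPairs R xs →
                  ∀ {i j} → i Fin.< j → R (List.lookup xs i) (List.lookup xs j)
AllPairs-lookup {xs = _ ∷ xs} (r ∷ _) {zero}  {suc j} _           =
  All.lookup r (∈-lookup {xs = xs} j)
AllPairs-lookup (_ ∷ rs)  {suc i} {suc j} (ℕ.s≤s i<j) = AllPairs-lookup rs i<j

-- Rooted trees

root : Tree A → A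
root (node a _) = a

-- The mutual pair `go` and `gos` makes the recursion through lists of children structural, so that
-- an induction hypothesis for all children can be stated with `All`.
tree-ind : {P : Tree A → Set ℓ} →
           (∀ a {ts} → All P ts → P (node a ts)) → ∀ t → P t
tree-ind {A = A} {P = P} P-node = go
  where
  go  : ∀ t → P t
  gos : (ts : List (Tree A)) → All P ts
  go (node a ts) = P-node a (gos ts)
  gos []       = []
  gos (t ∷ ts) = go t ∷ gos ts

Edge : Tree A → A → A → Set
Edge t x y = ∃ λ ts → node x ts ⊑ t × y ∈ map root ts

module _ {A : Set} where

  private
    variable
      s t u v : Tree A
      ts us : List (Tree A)
      x y z : A

  root∈labels : (t : Tree A) → root t ∈ labels t
  root∈labels (node _ _) = here refl

  ∈-labelss⁺ : u ∈ ts → x ∈ labels u → x ∈ labelss ts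
  ∈-labelss⁺ (here refl) x∈ = ∈-++⁺ˡ x∈
  ∈-labelss⁺ {ts = t ∷ _} (there u∈) x∈ = ∈-++⁺ʳ (labels t) (∈-labelss⁺ u∈ x∈)

  ∈-labelss⁻ : ∀ ts → x ∈ labelss ts → ∃ λ u → u ∈ ts × x ∈ labels u
  ∈-labelss⁻ (t ∷ ts) x∈ with ∈-++⁻ (labels t) x∈
  ... | inj₁ x∈t = t , here refl , x∈t
  ... | inj₂ x∈ts with ∈-labelss⁻ ts x∈ts
  ...   | u , u∈ , x∈u = u , there u∈ , x∈u

  ⊑⇒root∈labels : s ⊑ t → root s ∈ labels t
  ⊑⇒root∈labels {s = s} here = root∈labels s
  ⊑⇒root∈labels (below u∈ s⊑u) = there (∈-labelss⁺ u∈ (⊑⇒root∈labels s⊑u))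

  ⊑-trans : s ⊑ t → t ⊑ u → s ⊑ u
  ⊑-trans p here        = p
  ⊑-trans p (below q r) = below q (⊑-trans p r)

  edge⇒parent∈labels : Edge t x y → x ∈ labels t
  edge⇒parent∈labels (_ , p , _) = ⊑⇒root∈labels p

  edge⇒child∈labels : Edge t x y → y ∈ labels t
  edge⇒child∈labels (_ , p , y∈) with ∈-map⁻ root y∈
  ... | u , u∈ , refl = ⊑⇒root∈labels (⊑-trans (below u∈ here) p)

  -- Walks down from the root: `Q` passes along an edge to the root of the child that holds the
  -- label, and the edges of that child are edges of `t`.
  labels-ind : (Q : A → Set) → ∀ t → Q (root t) →
               (∀ {x y} → Edge t x y → Q x → Q y) → ∀ {x} → x ∈ labels t → Q x
  labels-ind Q = tree-ind descend
    where
    descend : ∀ a {ts} → All _ ts → _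
    descend a ih q₀ q (here refl) = q₀
    descend a {ts} ih q₀ q (there x∈) with ∈-labelss⁻ ts x∈
    ... | u , u∈ , x∈u = All.lookup ih u∈
      (q (_ , here , ∈-map⁺ root u∈) q₀)
      (λ { (_ , p , y∈) → q (_ , below u∈ p , y∈) }) x∈u

  root-or-child : ∀ t → x ∈ labels t → x ≡ root t ⊎ ∃ λ y → Edge t y x
  root-or-child t = labels-ind (λ x → x ≡ root t ⊎ ∃ λ y → Edge t y x) t
    (inj₁ refl) (λ e _ → inj₂ (_ , e))

  ∈labels⇒⊑ : ∀ t → x ∈ labels t → ∃ λ ts → node x ts ⊑ t
  ∈labels⇒⊑ t = labels-ind (λ x → ∃ λ ts → node x ts ⊑ t) t (root⊑ t) child⊑
    where
    root⊑ : ∀ t → ∃ λ ts → node (root t) ts ⊑ t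
    root⊑ (node _ ts) = ts , here
    child⊑ : ∀ {x y} → Edge t x y → _ → ∃ λ ts → node y ts ⊑ t
    child⊑ (_ , p , y∈) _ with ∈-map⁻ root y∈
    ... | node _ ts , u∈ , refl = ts , ⊑-trans (below u∈ here) p

  unique-child : Unique (labelss ts) → u ∈ ts → Unique (labels u)
  unique-child {ts = t ∷ _} uniq (here refl) = proj₁ (Unique-++⁻ (labels t) uniq)
  unique-child {ts = t ∷ _} uniq (there u∈)  =
    unique-child (proj₁ (proj₂ (Unique-++⁻ (labels t) uniq))) u∈

  same-child : Unique (labelss ts) → u ∈ ts → v ∈ ts →
               x ∈ labels u → x ∈ labels v → u ≡ v
  same-child {ts = t ∷ _} uniq p q x∈u x∈v with Unique-++⁻ (labels t) uniq | p | q
  ... | _ , _ , _    | here refl | here refl = refl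
  ... | _ , _ , disj | here refl | there q′  = contradiction (x∈u , ∈-labelss⁺ q′ x∈v) disj
  ... | _ , _ , disj | there p′  | here refl = contradiction (x∈v , ∈-labelss⁺ p′ x∈u) disj
  ... | _ , un , _   | there p′  | there q′  = same-child un p′ q′ x∈u x∈v

  unique-roots : ∀ ts → Unique (labelss ts) → Unique (map root ts)
  unique-roots []       _    = []
  unique-roots (t ∷ ts) uniq with Unique-++⁻ (labels t) uniq
  ... | _ , un , disj = All.tabulate distinct ∷ unique-roots ts un
    where
    distinct : ∀ {x} → x ∈ map root ts → root t ≢ x
    distinct x∈ refl with ∈-map⁻ root x∈
    ... | u , u∈ , eq = disj (root∈labels t ,
      ∈-labelss⁺ u∈ (subst (_∈ labels u) (sym eq) (root∈labels u)))

  unique-⊑ : Unique (labels t) → s ⊑ t → Unique (labels s)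
  unique-⊑ uniq       here         = uniq
  unique-⊑ (_ ∷ uniq) (below u∈ p) = unique-⊑ (unique-child uniq u∈) p

  -- Distinct labels let a label name a single vertex: if one occurrence is the root, the other
  -- cannot lie below it; otherwise both lie in the same child.
  node-unique : Unique (labels t) → node x ts ⊑ t → node x us ⊑ t → ts ≡ us
  node-unique uniq here here = refl
  node-unique uniq here (below u∈ p) =
    contradiction (∈-labelss⁺ u∈ (⊑⇒root∈labels p)) (Unique[x∷xs]⇒x∉xs uniq)
  node-unique uniq (below u∈ p) here =
    contradiction (∈-labelss⁺ u∈ (⊑⇒root∈labels p)) (Unique[x∷xs]⇒x∉xs uniq)
  node-unique (_ ∷ uniq) (below u∈ p) (below v∈ q)
    with refl ← same-child uniq u∈ v∈ (⊑⇒root∈labels p) (⊑⇒root∈labels q) =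
    node-unique (unique-child uniq u∈) p q

  root-not-child : Unique (labels t) → ¬ Edge t x (root t)
  root-not-child {t = node a ts} uniq (_ , here , a∈) with ∈-map⁻ root a∈
  ... | u , u∈ , refl = Unique[x∷xs]⇒x∉xs uniq (∈-labelss⁺ u∈ (root∈labels u))
  root-not-child {t = node a ts} uniq (_ , below u∈ p , a∈) =
    Unique[x∷xs]⇒x∉xs uniq (∈-labelss⁺ u∈ (edge⇒child∈labels (_ , p , a∈)))

  -- The child with root `z` is the only one whose labels include `z`, and a root has no parent
  -- within its own tree.
  child-not-deeper : Unique (labelss ts) → z ∈ map root ts → u ∈ ts → ¬ Edge u x z
  child-not-deeper uniq z∈ u∈ edge with ∈-map⁻ root z∈
  ... | v , v∈ , refl
    with refl ← same-child uniq v∈ u∈ (root∈labels v) (edge⇒child∈labels edge) =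
    root-not-child (unique-child uniq u∈) edge

  -- Makes the parent of a label well defined, which is needed for a tree to realize the sequence of
  -- its parents.
  parent-unique : Unique (labels t) → node x ts ⊑ t → node y us ⊑ t →
                  z ∈ map root ts → z ∈ map root us → x ≡ y
  parent-unique _ here here _ _ = refl
  parent-unique (_ ∷ uniq) here (below v∈ q) z∈ z∈′ =
    contradiction (_ , q , z∈′) (child-not-deeper uniq z∈ v∈)
  parent-unique (_ ∷ uniq) (below u∈ p) here z∈ z∈′ =
    contradiction (_ , p , z∈) (child-not-deeper uniq z∈′ u∈)
  parent-unique (_ ∷ uniq) (below u∈ p) (below v∈ q) z∈ z∈′
    with refl ← same-child uniq u∈ v∈ (edge⇒child∈labels (_ , p , z∈))
                                      (edge⇒child∈labels (_ , q , z∈′)) =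
    parent-unique (unique-child uniq u∈) p q z∈ z∈′

  ≅⇒root≡ : t ≅ u → root t ≡ root u
  ≅⇒root≡ (node _) = refl

  ≅-⊑ : t ≅ u → node x us ⊑ u →
        ∃ λ ts → node x ts ⊑ t × Perm.Permutation _≅_ ts us
  ≅-⊑ (node p) here = _ , here , p
  ≅-⊑ {t = t} {u = u} (node p) (below v∈ q)
    -- The permutation preserves children only up to `≅`, so what is transported is the existence of
    -- a child that is `≅` to the given one, not membership.
    with PermSetoid.Any-resp-↭ (unorderedTrees A) {P = λ w → w ≅ _}
           (λ x≈y x≅ → ≅-trans (≅-sym x≈y) x≅) (≅-symₚ p)
           (Any.map (λ { refl → ≅-refl _ }) v∈)
  ... | any with find any
  ...   | w , w∈ , w≅v with ≅-⊑ w≅v q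
  ...     | ts , s⊑w , r = ts , below w∈ s⊑w , r

  ≅-roots : Perm.Permutation _≅_ ts us → map root ts ↭ map root us
  ≅-roots = ↭ₛ⇒↭ ∘ PermSetoid.map⁺ (unorderedTrees A) (setoid A) ≅⇒root≡

-- Increasing paths and increasing edges.

module _ {n : ℕ} where

  private
    variable
      s t u : Tree (Fin n)
      x y : Fin n

  -- Only complete paths down to a leaf are known to increase, so an edge has to be prolonged to a
  -- leaf before its ends can be compared.
  path-exists : (t : Tree (Fin n)) → ∃ λ p → RootLeafPath t (root t ∷ p)
  path-exists = tree-ind extend
    where
    extend : ∀ a {ts} → All (λ t → ∃ λ p → RootLeafPath t (root t ∷ p)) ts →
             ∃ λ p → RootLeafPath (node a ts) (a ∷ p)
    extend a []            = _ , leaf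
    extend a ((_ , p) ∷ _) = _ , step (here refl) p

  edge-<⇒linked : ∀ {p} → RootLeafPath t p → (∀ {x y} → Edge t x y → x Fin.< y) →
                  Linked Fin._<_ p
  edge-<⇒linked leaf lt = [-]
  edge-<⇒linked (step u∈ leaf) lt = lt (_ , here , ∈-map⁺ root u∈) ∷ [-]
  edge-<⇒linked (step u∈ p@(step _ _)) lt =
    lt (_ , here , ∈-map⁺ root u∈) ∷
    edge-<⇒linked p (λ { (_ , q , y∈) → lt (_ , below u∈ q , y∈) })

  linked⇒edge-< : (∀ {p} → RootLeafPath t p → Linked Fin._<_ p) →
                  Edge t x y → x Fin.< y
  linked⇒edge-< inc (_ , here , y∈) with ∈-map⁻ root y∈
  ... | u , u∈ , refl = Linked.head (inc (step u∈ (proj₂ (path-exists u))))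
  linked⇒edge-< inc (_ , below u∈ p , y∈) =
    linked⇒edge-< (λ q → Linked.tail (inc (step u∈ q))) (_ , p , y∈)

-- The trees described by a sequence

-- The position i : Fin n stands for the vertex suc i : Fin (suc n), since the
-- root 0 has no parent.  positions is kept from unfolding so that e can be inferred from children e v.
opaque

  positions : Vec ℤ n → Fin (suc n) → List (Fin n)
  positions e v = filter (λ i → lookup e i ℤₚ.≟ + toℕ v) (allFin _)

  ∈-positions⁺ : ∀ {e : Vec ℤ n} {v i} → lookup e i ≡ + toℕ v → i ∈ positions e v
  ∈-positions⁺ eq = ∈-filter⁺ _ (∈-allFin _) eq

  ∈-positions⁻ : ∀ {e : Vec ℤ n} {v i} → i ∈ positions e v → lookup e i ≡ + toℕ v
  ∈-positions⁻ {e = e} {v} i∈ =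
    proj₂ (∈-filter⁻ (λ i → lookup e i ℤₚ.≟ + toℕ v) {xs = allFin _} i∈)

  positions-sorted : (e : Vec ℤ n) (v : Fin (suc n)) → AllPairs Fin._<_ (positions e v)
  positions-sorted e v = AllPairsₚ.filter⁺ _ (AllPairsₚ.tabulate⁺-< id)

children : Vec ℤ n → Fin (suc n) → List (Fin (suc n))
children e v = map suc (positions e v)

-- Stated on labels and up to `↭`, since children are unordered. The root label is left free, so
-- that every subtree of a realization is again one.
Realizes : Vec ℤ n → Tree (Fin (suc n)) → Set
Realizes e t = ∀ {a ts} → node a ts ⊑ t → map root ts ↭ children e a

module _ {n : ℕ} {e : Vec ℤ n} where

  private
    variable
      t u : Tree (Fin (suc n))
      v v′ x y : Fin (suc n)

  ∈-children⁺ : ∀ {i} → lookup e i ≡ + toℕ v → suc i ∈ children e v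
  ∈-children⁺ eq = ∈-map⁺ suc (∈-positions⁺ eq)

  ∈-children⁻ : x ∈ children e v → ∃ λ i → x ≡ suc i × lookup e i ≡ + toℕ v
  ∈-children⁻ x∈ with ∈-map⁻ suc x∈
  ... | i , i∈ , refl = i , refl , ∈-positions⁻ i∈

  children-unique : ∀ v → Unique (children e v)
  children-unique v = Uniqueₚ.map⁺ Finₚ.suc-injective
    (AllPairs.map Finₚ.<⇒≢ (positions-sorted e v))

  children-parent : x ∈ children e v → x ∈ children e v′ → v ≡ v′
  children-parent p q with ∈-children⁻ p | ∈-children⁻ q
  ... | _ , refl , eq | _ , refl , eq′ =
    Finₚ.toℕ-injective (ℤₚ.+-injective (trans (sym eq) eq′))

  edge⇒children : Realizes e t → Edge t x y → y ∈ children e x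
  edge⇒children r (_ , p , y∈) = ∈-resp-↭ (r p) y∈

  children⇒edge : Realizes e t → x ∈ labels t → y ∈ children e x → Edge t x y
  children⇒edge {t = t} r x∈ y∈ with ∈labels⇒⊑ t x∈
  ... | _ , p = _ , p , ∈-resp-↭ (↭-sym (r p)) y∈

  realizes-child : ∀ {a ts} → Realizes e (node a ts) → All (Realizes e) ts
  realizes-child r = All.tabulate (λ u∈ p → r (below u∈ p))

  realizes-node : ∀ {a ts} → map root ts ↭ children e a → All (Realizes e) ts →
                  Realizes e (node a ts)
  realizes-node p rs here         = p
  realizes-node p rs (below u∈ q) = All.lookup rs u∈ q

  realizes-resp-≅ : t ≅ u → Realizes e t → Realizes e u
  realizes-resp-≅ t≅u r q with ≅-⊑ t≅u q
  ... | _ , p , perm = ↭-trans (↭-sym (≅-roots perm)) (r p)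

  -- Equal roots have the same prescribed children, so the children of `t` can be reordered to match
  -- those of `u` root by root; induction compares the matched pairs.
  realizes⇒≅ : ∀ t → Realizes e t → ∀ {u} → Realizes e u → root t ≡ root u → t ≅ u
  realizes⇒≅ = tree-ind determined
    where
    Determined : Tree (Fin (suc n)) → Set
    Determined t = ∀ {u} → Realizes e u → root t ≡ root u → t ≅ u

    pointwise : ∀ {ts us} → All Determined ts → All (Realizes e) us →
                map root us ≡ map root ts → Pointwise _≅_ ts us
    pointwise []       []       _  = []
    pointwise (d ∷ ds) (r ∷ rs) eq with ∷-injective eq
    ... | eq₁ , eq₂ = d r (sym eq₁) ∷ pointwise ds rs eq₂

    determined : ∀ a {ts} → All (λ t → Realizes e t → Determined t) ts →
                 Realizes e (node a ts) → Determined (node a ts)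
    determined a ih r {node _ us} r′ refl
      with ↭-map-inv root (↭-trans (r here) (↭-sym (r′ here)))
    -- `zs` is `ts` reordered so that its list of roots equals that of `us`.
    ... | zs , eq , ts↭zs = node (Perm.trans
      (↭⇒↭ₛ′ (Setoid.isEquivalence (unorderedTrees _)) ts↭zs)
      (Perm.refl (pointwise
        (All-resp-↭ ts↭zs (All.tabulate (λ u∈ → All.lookup ih u∈ (λ p → r (below u∈ p)))))
        (realizes-child r′) eq)))

-- From inversion sequences to label-increasing trees.

module _ {n : ℕ} {e : Vec ℤ n} (inv : IsInversionSequence e) where

  private
    variable
      t u : Tree (Fin (suc n))
      v x : Fin (suc n)

  parent-exists : ∀ i → ∃ λ v → lookup e i ≡ + toℕ v
  parent-exists i with lookup e i | inv i
  ... | + m | _ , +<+ m< =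
    fromℕ< (ℕₚ.<-trans m< (ℕ.s<s (Finₚ.toℕ<n i))) , cong +_ (sym (Finₚ.toℕ-fromℕ< _))

  -- The strict bound on entry `i` is `suc (toℕ i)`, exactly the label of the vertex `suc i`; the
  -- inversion condition therefore says that parents are smaller.
  children-< : x ∈ children e v → v Fin.< x
  children-< x∈ with ∈-children⁻ x∈
  ... | i , refl , eq = ℤₚ.drop‿+<+ (subst (ℤ._< _) eq (proj₂ (inv i)))

  -- The parent that `e` gives to `suc i` occurs in `t`, so the corresponding edge is in `t`, and
  -- `e′` must record the same edge.
  realizes-functional : ∀ {e′} → (∀ w → w ∈ labels t) →
                        Realizes e t → Realizes e′ t → e ≡ e′
  realizes-functional {e′ = e′} full r r′ = Pointwise-≡⇒≡ (ext same)
    where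
    same : ∀ i → lookup e i ≡ _
    same i with parent-exists i
    ... | v , eᵢ
      with ∈-children⁻ (edge⇒children {e = e′} r′ (children⇒edge r (full v) (∈-children⁺ eᵢ)))
    ...   | _ , refl , eᵢ′ = trans eᵢ (sym eᵢ′)

  private
    -- Children carry larger labels and labels are bounded, so attaching the prescribed children
    -- terminates.
    build : ∀ v → Acc Fin._>_ v → ∃ λ t → root t ≡ v × Realizes e t
    build v (acc rs) with gather (All.tabulate (λ {w} w∈ → build w (rs (children-< w∈))))
      where
      gather : ∀ {vs} → All (λ v → ∃ λ t → root t ≡ v × Realizes e t) vs →
               ∃ λ ts → map root ts ≡ vs × All (Realizes e) ts
      gather [] = [] , refl , []
      gather ((t , refl , r) ∷ ps) with gather ps
      ... | ts , refl , rs = t ∷ ts , refl , r ∷ rs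
    ... | ts , eq , rs′ = node v ts , refl , realizes-node (↭-reflexive eq) rs′

  realization : ∃ λ t → root t ≡ zero × Realizes e t
  realization = build zero (>-wellFounded zero)

  root-≤ : Realizes e t → x ∈ labels t → root t Fin.≤ x
  root-≤ {t = t} r = labels-ind (root t Fin.≤_) t ℕₚ.≤-refl
    (λ edge le → ℕₚ.≤-trans le (ℕₚ.<⇒≤ (children-< (edge⇒children r edge))))

  -- A shared label has the same parent in both trees, so one can climb until a root is met. If only
  -- one of the trees has its root there, the other would contain the common parent `v`.
  siblings-disjoint : Realizes e t → Realizes e u →
                      root t ∈ children e v → root u ∈ children e v →
                      x ∈ labels t → x ∈ labels u → root t ≡ root u
  siblings-disjoint {t = t} {u = u} r r′ t∈ u∈ =
    labels-ind (λ x → x ∈ labels u → root t ≡ root u) t base next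
    where
    -- A parent v of both roots is smaller than they are, so it is in neither tree.
    foreign : ∀ {v t} → Realizes e t → root t ∈ children e v → ¬ v ∈ labels t
    foreign r t∈ v∈ = ℕₚ.<⇒≱ (children-< t∈) (root-≤ r v∈)

    base : root t ∈ labels u → root t ≡ root u
    base t∈u with root-or-child u t∈u
    ... | inj₁ eq = eq
    ... | inj₂ (_ , edge)
      with refl ← children-parent t∈ (edge⇒children r′ edge) =
      contradiction (edge⇒parent∈labels edge) (foreign r′ u∈)

    next : ∀ {x y} → Edge t x y → (x ∈ labels u → root t ≡ root u) →
           y ∈ labels u → root t ≡ root u
    next edge ih y∈u with root-or-child u y∈u
    ... | inj₁ refl
      with refl ← children-parent u∈ (edge⇒children r edge) =
      contradiction (edge⇒parent∈labels edge) (foreign r t∈)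
    ... | inj₂ (_ , edge′)
      with refl ← children-parent (edge⇒children r edge) (edge⇒children r′ edge′) =
      ih (edge⇒parent∈labels edge′)

  -- A repetition is excluded within a child by induction, between children by `siblings-disjoint`,
  -- and with the root because labels below it are larger.
  realizes⇒unique : ∀ t → Realizes e t → Unique (labels t)
  realizes⇒unique = tree-ind unique
    where
    forest : ∀ {v ts} → All (Realizes e) ts → All (λ t → root t ∈ children e v) ts →
             Unique (map root ts) → All (Unique ∘ labels) ts → Unique (labelss ts)
    forest [] [] [] [] = []
    forest {ts = t ∷ ts} (r ∷ rs) (c ∷ cs) (≢s ∷ roots) (un ∷ uns) =
      Uniqueₚ.++⁺ un (forest rs cs roots uns) disj
      where
      disj : Disjoint (labels t) (labelss ts)
      disj (x∈t , x∈ts) with ∈-labelss⁻ ts x∈ts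
      ... | u , u∈ , x∈u = All.lookup ≢s (∈-map⁺ root u∈)
        (siblings-disjoint r (All.lookup rs u∈) c (All.lookup cs u∈) x∈t x∈u)

    unique : ∀ a {ts} → All (λ t → Realizes e t → Unique (labels t)) ts →
           Realizes e (node a ts) → Unique (a ∷ labelss ts)
    unique a {ts} ih r =
      All.tabulate (λ x∈ eq → a∉ (subst (_∈ labelss ts) (sym eq) x∈)) ∷
      forest rs (All.tabulate child)
        (PermSetoid.Unique-resp-↭ (setoid _) (↭⇒↭ₛ (↭-sym (r here))) (children-unique a))
        (All.tabulate (λ u∈ → All.lookup ih u∈ (λ p → r (below u∈ p))))
      where
      rs = realizes-child r
      child : ∀ {u} → u ∈ ts → root u ∈ children e a
      child u∈ = edge⇒children r (_ , here , ∈-map⁺ root u∈)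
      a∉ : a ∉ labelss ts
      a∉ a∈ with ∈-labelss⁻ ts a∈
      ... | u , u∈ , a∈u =
        ℕₚ.<⇒≱ (children-< (child u∈)) (root-≤ (All.lookup rs u∈) a∈u)

  -- Strong induction on the label: the parent of `suc i` is smaller, hence already in `t`, and
  -- `suc i` is one of its children.
  realizes⇒full : Realizes e t → root t ≡ zero → ∀ w → w ∈ labels t
  realizes⇒full {t = t} r eq w = go w (FinInd.<-wellFounded w)
    where
    go : ∀ w → Acc Fin._<_ w → w ∈ labels t
    go zero    _        = subst (_∈ labels t) eq (root∈labels t)
    go (suc i) (acc rs) with parent-exists i
    ... | v , eᵢ = edge⇒child∈labels
      (children⇒edge r (go v (rs (children-< (∈-children⁺ eᵢ)))) (∈-children⁺ eᵢ))

  realizes⇒labelIncreasing : Realizes e t → root t ≡ zero → IsLabelIncreasing t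
  realizes⇒labelIncreasing {t = t} r eq = record
    { size       = trans (↭-length (unique-↭ un (Uniqueₚ.allFin⁺ _)
                           (λ _ → ∈-allFin _) (λ _ → realizes⇒full r eq _)))
                         (length-tabulate id)
    ; distinct   = un
    ; increasing = λ p → edge-<⇒linked p (children-< ∘ edge⇒children r)
    }
    where un = realizes⇒unique t r

-- From label-increasing trees to sequences of parents.

module _ {n : ℕ} {t : Tree (Fin (suc n))} (inc : IsLabelIncreasing t) where

  open IsLabelIncreasing inc

  labelIncreasing⇒full : ∀ w → w ∈ labels t
  labelIncreasing⇒full = unique-full distinct size

  -- The label `zero` occurs in `t`, and a parent of it would need a smaller label.
  labelIncreasing⇒root : root t ≡ zero
  labelIncreasing⇒root with root-or-child t (labelIncreasing⇒full zero)
  ... | inj₁ eq = sym eq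
  ... | inj₂ (_ , edge) with () ← linked⇒edge-< increasing edge

  private
    RecordsEdges : Vec ℤ n → Set
    RecordsEdges e = ∀ i → ∃ λ v → lookup e i ≡ + toℕ v × Edge t v (suc i)

  recordsEdges⇒inversion : ∀ {e} → RecordsEdges e → IsInversionSequence e
  recordsEdges⇒inversion {e} rec i with lookup e i | rec i
  ... | _ | _ , refl , edge = +≤+ ℕ.z≤n , +<+ (linked⇒edge-< increasing edge)

  -- Both lists are free of repetitions, so it suffices to compare their elements. One inclusion
  -- rests on the uniqueness of parents, the other on a label naming a single vertex.
  recordsEdges⇒realizes : ∀ {e} → RecordsEdges e → Realizes e t
  recordsEdges⇒realizes {e} rec {a} {ts} p =
    unique-↭ (unique-roots ts (AllPairs.tail (unique-⊑ distinct p))) (children-unique a) to from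
    where
    to : ∀ {w} → w ∈ map root ts → w ∈ children e a
    to {zero}  w∈ with () ← linked⇒edge-< increasing (_ , p , w∈)
    to {suc i} w∈ with rec i
    ... | _ , eq , _ , q , w∈′ =
      ∈-children⁺ (trans eq (cong (+_ ∘ toℕ) (parent-unique distinct q p w∈′ w∈)))

    from : ∀ {w} → w ∈ children e a → w ∈ map root ts
    from w∈ with ∈-children⁻ w∈
    ... | i , refl , eq with rec i
    ...   | v , eq′ , _ , q , w∈′
      with refl ← Finₚ.toℕ-injective {i = v} {j = a} (ℤₚ.+-injective (trans (sym eq′) eq))
      with refl ← node-unique distinct p q = w∈′

  parent : ∀ i → ∃ λ v → Edge t v (suc i)
  parent i with root-or-child t (labelIncreasing⇒full (suc i))
  ... | inj₁ eq with () ← trans eq labelIncreasing⇒root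
  ... | inj₂ p = p

  parents : Vec ℤ n
  parents = Vec.tabulate (λ i → + toℕ (proj₁ (parent i)))

  private
    parents-recordsEdges : RecordsEdges parents
    parents-recordsEdges i = _ , lookup∘tabulate _ i , proj₂ (parent i)

  parents-inversion : IsInversionSequence parents
  parents-inversion = recordsEdges⇒inversion {parents} parents-recordsEdges

  parents-realizes : Realizes parents t
  parents-realizes = recordsEdges⇒realizes parents-recordsEdges

-- Occurrences of the pattern and numbers of children.

module _ {n : ℕ} {e : Vec ℤ n} where

  private
    variable
      t : Tree (Fin (suc n))

  -- The first `k` positions of the value `v`, listed in increasing order, form an occurrence.
  positions⇒contains : ∀ v → k ≤ length (positions e v) → Contains e (replicate k 0ℤ)
  positions⇒contains {k = k} v k≤ = record
    { index      = index
    ; increasing = λ i<j → AllPairs-lookup (positions-sorted e v)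
        (subst₂ ℕ._<_ (sym (Finₚ.toℕ-inject≤ _ k≤)) (sym (Finₚ.toℕ-inject≤ _ k≤)) i<j)
    ; same-<     = λ i j → mk⇔ (λ lt → contradiction lt (ℤₚ.<-irrefl (e-const i j)))
                               (λ lt → contradiction lt (ℤₚ.<-irrefl (0-const i j)))
    ; same-≡     = λ i j → mk⇔ (λ _ → 0-const i j) (λ _ → e-const i j)
    }
    where
    index : Fin k → Fin n
    index i = List.lookup (positions e v) (inject≤ i k≤)
    e-index : ∀ i → lookup e (index i) ≡ + toℕ v
    e-index i = ∈-positions⁻ (∈-lookup {xs = positions e v} (inject≤ i k≤))
    e-const : ∀ i j → lookup e (index i) ≡ lookup e (index j)
    e-const i j = trans (e-index i) (sym (e-index j))
    0-const : ∀ i j → lookup (replicate k 0ℤ) i ≡ lookup (replicate k 0ℤ) j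
    0-const i j = trans (lookup-replicate i 0ℤ) (sym (lookup-replicate j 0ℤ))

  -- The first entry of the occurrence supplies the value `v`; all other entries equal it, and the
  -- indices, being increasing, inject into the positions of `v`.
  contains⇒positions : IsInversionSequence e → Contains e (replicate (suc k) 0ℤ) →
                       ∃ λ v → suc k ≤ length (positions e v)
  contains⇒positions {k = k} inv c with parent-exists {e = e} inv (Contains.index c zero)
  ... | v , eq = v , Finₚ.injective⇒≤ {f = Any.index ∘ position}
    (λ {i} {j} → index-injective′ ∘ index-injective (position i) (position j))
    where
    open Contains c
    π-const : ∀ i → lookup (replicate (suc k) 0ℤ) i ≡ 0ℤ
    π-const i = lookup-replicate i 0ℤ
    position : ∀ i → index i ∈ positions e v
    position i = ∈-positions⁺
      -- The pattern entry at `zero` computes to `0ℤ`, so `π-const i` compares entry `i` with it.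
      (trans (Equivalence.from (same-≡ i zero) (π-const i)) eq)
    index-injective′ : ∀ {i j} → index i ≡ index j → i ≡ j
    index-injective′ {i} {j} eq with Finₚ.<-cmp i j
    ... | tri< i<j _ _ = contradiction (increasing i<j) (Finₚ.<-irrefl eq)
    ... | tri≈ _ i≡j _ = i≡j
    ... | tri> _ _ j<i = contradiction (increasing j<i) (Finₚ.<-irrefl (sym eq))

  realizes⇒length : Realizes e t → ∀ {a ts} → node a ts ⊑ t →
                    length ts ≡ length (positions e a)
  realizes⇒length r {a} {ts} p = trans (sym (length-map root ts))
    (trans (↭-length (r p)) (length-map suc (positions e a)))

  avoids⇒bounded : Realizes e t → Avoids e (replicate (suc k) 0ℤ) → BranchingBoundedBy k t
  avoids⇒bounded r av {a} p = ℕₚ.≮⇒≥ λ k< →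
    av (positions⇒contains a (subst (_ ≤_) (realizes⇒length r p) k<))

  bounded⇒avoids : IsInversionSequence e → (∀ v → v ∈ labels t) → Realizes e t →
                   BranchingBoundedBy k t → Avoids e (replicate (suc k) 0ℤ)
  bounded⇒avoids {t = t} inv full r bb c =
    -- The overfull value `v` refutes the bound only at a vertex of `t`, which `full` provides.
    let v , k< = contains⇒positions inv c
        _ , p  = ∈labels⇒⊑ t (full v)
    in ℕₚ.<⇒≱ k< (subst (_≤ _) (realizes⇒length r p) (bb p))

-- The two maps and their inverse laws.

theorem4p1 : (k n : ℕ) → 1 ≤ k → 1 ≤ n →
    Inverse (𝐈 n (replicate k 0ℤ)) (L (suc n) (k ∸ 1))
theorem4p1 (suc k) n _ _ = record
  { to        = λ (e , inv , av) → let t , t₀ , r = realization inv in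
      t , realizes⇒labelIncreasing inv r t₀ , avoids⇒bounded r av
  ; from      = λ (t , inc , bb) →
      parents inc , parents-inversion inc ,
      bounded⇒avoids (parents-inversion inc) (labelIncreasing⇒full inc) (parents-realizes inc) bb
  -- The tree is built from the proof `inv` as well, so equal sequences yield realizations that are
  -- only compared up to `≅`.
  ; to-cong   = λ { {_ , inv , _} {_ , inv′ , _} refl →
      let t , t₀ , r = realization inv; _ , u₀ , r′ = realization inv′ in
      realizes⇒≅ t r r′ (trans t₀ (sym u₀)) }
  ; from-cong = λ { {_ , inc , _} {_ , inc′ , _} t≅u → parents-≅ inc inc′ t≅u }
  ; inverse   =
      -- The tree `t` and the tree `u` built from its parents realize the same sequence with the
      -- same root.
      (λ { {t , inc , _} {_ , inv , _} refl →
        let u , u₀ , r = realization inv in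
        realizes⇒≅ u r (parents-realizes inc) (trans u₀ (sym (labelIncreasing⇒root inc))) })
    -- A tree that is `≅` to a realization of the sequence realizes it too, and it also realizes its
    -- own parents.
    , (λ { {_ , inv , _} {_ , inc , _} t≅u →
        sym (realizes-functional inv (labelIncreasing⇒full inc)
          (realizes-resp-≅ (≅-sym t≅u) (proj₂ (proj₂ (realization inv))))
          (parents-realizes inc)) })
  }
  where
  parents-≅ : ∀ {t u : Tree (Fin (suc n))} (inc : IsLabelIncreasing t)
              (inc′ : IsLabelIncreasing u) → t ≅ u → parents inc ≡ parents inc′
  parents-≅ inc inc′ t≅u = realizes-functional (parents-inversion inc)
    (labelIncreasing⇒full inc′) (realizes-resp-≅ t≅u (parents-realizes inc))
    (parents-realizes inc′)
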